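{- Let $d\geq 1$ and let $k$ be a positive integer. Then $$\left(k-1+\frac{1}{k}\right)^d\ \geq\ \inf_{\{0,1,\dots,k-1\}^d\subseteq A\subset\mathbb{Z}^d,\ A \text{ finite}}\frac{|kA|}{|A|}\ \geq\ k^{\frac{d(k-1)}{k}}.$$
   Context: For a set $A\subseteq\mathbb{Z}^d$, $kA=A+A+\dots+A$ ($k$ summands, Minkowski sum), and $|\cdot|$ denotes cardinality. -}

module Defs where

open import Data.Nat using (ℕ; zero; suc)
open import Data.Integer as ℤ using (ℤ; +_)
open import Data.Fin using (Fin; toℕ)
open import Data.Vec using (Vec; zipWith; replicate) renaming (map to vmap)
open import Data.Vec.Properties using (≡-dec)
open import Data.List using (List; length; deduplicate; cartesianProductWith; [_])
open import Data.List.Membership.Propositional using (_∈_)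
open import Relation.Binary.PropositionalEquality using (_≡_)
open import Relation.Binary.Definitions using (DecidableEquality)

Point : ℕ → Set
Point d = Vec ℤ d

_≟ₚ_ : ∀ {d} → DecidableEquality (Point d)
_≟ₚ_ = ≡-dec ℤ._≟_

_⊕_ : ∀ {d} → Point d → Point d → Point d
_⊕_ = zipWith ℤ._+_

-- A finite subset of ℤ^d is represented by a list (duplicates allowed);
-- its cardinality is the number of distinct entries.
card : ∀ {d} → List (Point d) → ℕ
card A = length (deduplicate _≟ₚ_ A)

sumset : ∀ {d} → List (Point d) → List (Point d) → List (Point d)
sumset A B = cartesianProductWith _⊕_ A B

mult : ∀ {d} → ℕ → List (Point d) → List (Point d)
mult zero A = [ replicate _ (+ 0) ]
mult (suc zero) A = A
mult (suc (suc k)) A = sumset A (mult (suc k) A)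

ContainsCube : ∀ {d} → ℕ → List (Point d) → Set
ContainsCube {d} k A = (f : Vec (Fin k) d) → vmap (λ i → + toℕ i) f ∈ A

{-# OPTIONS --safe #-}

-- Write k = j + 1 and U = {0,…,j}^d. The upper bound is attained by A = U. The lower bound follows
-- from |kA| |U + jA|^j ≥ k^(dj) |A|^k, valid for every finite A, since U + jA ⊆ kA once U ⊆ A.
-- This inequality is proved by induction on d. Let Aᵢ ⊆ ℤ^(d-1) be the set of points over which A
-- has more than i points, so that |A| = Σᵢ |Aᵢ|. From |X + Y| ≥ |X| + |Y| - 1 in ℤ, the set kA has at
-- least ki + 1 points over each point of kAᵢ, and U + jA at least ji + k over each point of U′ + jAᵢ
-- (U′ the cube in ℤ^(d-1)). Hence
--   |kA| ≥ |kA₀| + k Σ_{i≥1} |kAᵢ|   and   |U + jA| ≥ k |U′ + jA₀| + j Σ_{i≥1} |U′ + jAᵢ|,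
-- and the induction hypotheses for the Aᵢ are combined by superadditivity of the weighted
-- geometric mean, using k j^j ≥ k^j.

module Submission where

open import Defs
open import Data.Nat hiding (_≟_)
open import Data.Nat.Properties hiding (_≟_)
open import Data.Nat.ListAction using (sum)
open import Data.Nat.Tactic.RingSolver using (solve-∀)
open import Data.Bool using (if_then_else_)
open import Data.Integer as ℤ using (ℤ)
import Data.Integer.Properties as ℤ
open import Algebra.Properties.AbelianGroup ℤ.+-0-abelianGroup using (∙-cancelˡ; ∙-cancelʳ)
open import Data.Fin using (Fin; toℕ; fromℕ<)
open import Data.Fin.Properties using (toℕ<n; toℕ-fromℕ<)
open import Data.Vec using (Vec; []; _∷_; head; tail; replicate) renaming (map to vmap)
open import Data.List using (List; []; _∷_; [_]; _++_; length; map; filter; deduplicate; concatMap; cartesianProductWith; upTo)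
open import Data.List.Properties using (length-++; length-++-sucʳ; length-map; length-filter; length-deduplicate; length-upTo; map-cong)
open import Data.List.Membership.Propositional using (_∈_)
open import Data.List.Membership.Propositional.Properties
import Data.List.Membership.DecPropositional as DecMembership
open import Data.List.Relation.Binary.Subset.Propositional using (_⊆_)
open import Data.List.Relation.Unary.All as All using ([]; _∷_)
import Data.List.Relation.Unary.All.Properties as All
open import Data.List.Relation.Unary.AllPairs as AllPairs using ([]; _∷_)
import Data.List.Relation.Unary.AllPairs.Properties as AllPairs
open import Data.List.Relation.Unary.Any as Any using (here; there)
open import Data.List.Relation.Unary.Unique.Propositional using (Unique)
import Data.List.Relation.Unary.Unique.Propositional.Properties as Unique
import Data.List.Relation.Unary.Unique.DecPropositional.Properties as UniqueDec
open import Data.Product using (_×_; _,_; proj₁; proj₂; ∃; Σ-syntax)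
open import Data.Sum using (inj₁; inj₂)
open import Function using (_∘_; flip; it)
open import Relation.Binary using (Total; Transitive; DecidableEquality)
open import Relation.Nullary using (¬_; ¬?; yes; no; does; contradiction)
open import Relation.Binary.PropositionalEquality
  using (_≡_; _≢_; refl; sym; trans; cong; cong₂; subst; subst₂)

-- Power inequalities over ℕ: weighted AM-GM and its consequences.

^-cancelˡ-≤ : ∀ k {a b} → a ^ suc k ≤ b ^ suc k → a ≤ b
^-cancelˡ-≤ k aᵏ≤bᵏ = ≮⇒≥ λ b<a → <⇒≱ (^-monoˡ-< (suc k) b<a) aᵏ≤bᵏ

^-cancelˡ-< : ∀ k {a b} → a ^ k < b ^ k → a < b
^-cancelˡ-< k aᵏ<bᵏ = ≰⇒> λ b≤a → <⇒≱ aᵏ<bᵏ (^-monoˡ-≤ k b≤a)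

^-distribʳ-* : ∀ a b k → (a * b) ^ k ≡ a ^ k * b ^ k
^-distribʳ-* a b zero    = refl
^-distribʳ-* a b (suc k) = trans (cong (a * b *_) (^-distribʳ-* a b k)) (eq a b (a ^ k) (b ^ k))
  where
  eq : ∀ a b s t → a * b * (s * t) ≡ a * s * (b * t)
  eq = solve-∀

2ab≤a²+b² : ∀ a b → 2 * (a * b) ≤ a * a + b * b
2ab≤a²+b² a b with ≤-total a b
... | inj₁ a≤b with k , refl ← m≤n⇒∃[o]m+o≡n a≤b =
  ≤-trans (m≤m+n _ (k * k)) (≤-reflexive (eq a k))
  where
  eq : ∀ a k → 2 * (a * (a + k)) + k * k ≡ a * a + (a + k) * (a + k)
  eq = solve-∀
... | inj₂ b≤a with k , refl ← m≤n⇒∃[o]m+o≡n b≤a =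
  ≤-trans (m≤m+n _ (k * k)) (≤-reflexive (eq b k))
  where
  eq : ∀ b k → 2 * ((b + k) * b) + k * k ≡ (b + k) * (b + k) + b * b
  eq = solve-∀

-- AM-GM for a^(m+1) and m copies of b^(m+1), free of roots. The inductive step adds `a` times the
-- previous case to `suc m * b ^ m` times `2ab≤a²+b²`; `c` collects the terms common to both sides,
-- which avoids subtraction.
bernoulli : ∀ m a b → suc m * (a * b ^ m) ≤ a ^ suc m + m * b ^ suc m
bernoulli zero    a b = ≤-reflexive (eq a)
  where
  eq : ∀ a → 1 * (a * 1) ≡ a * 1 + 0
  eq = solve-∀
bernoulli (suc m) a b = +-cancelˡ-≤ c _ _ (begin
    c + suc (suc m) * (a * (b * b ^ m))
  ≡⟨ eq₁ m a b (b ^ m) ⟩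
    a * (suc m * (a * b ^ m)) + suc m * b ^ m * (2 * (a * b))
  ≤⟨ +-mono-≤ (*-monoʳ-≤ a (bernoulli m a b)) (*-monoʳ-≤ (suc m * b ^ m) (2ab≤a²+b² a b)) ⟩
    a * (a ^ suc m + m * (b * b ^ m)) + suc m * b ^ m * (a * a + b * b)
  ≡⟨ eq₂ m a b (b ^ m) (a ^ suc m) ⟩
    c + (a * a ^ suc m + suc m * (b * (b * b ^ m)))
  ∎)
  where
  open ≤-Reasoning
  c = m * (a * (b * b ^ m)) + suc m * (a * a * b ^ m)
  eq₁ : ∀ m a b t → m * (a * (b * t)) + suc m * (a * a * t) + suc (suc m) * (a * (b * t))
                  ≡ a * (suc m * (a * t)) + suc m * t * (2 * (a * b))
  eq₁ = solve-∀
  eq₂ : ∀ m a b t s → a * (s + m * (b * t)) + suc m * t * (a * a + b * b)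
                  ≡ m * (a * (b * t)) + suc m * (a * a * t) + (a * s + suc m * (b * (b * t)))
  eq₂ = solve-∀

-- `bernoulli` with a = u + j v and b = (1 + j) v: the difference (1 + j) a b^j - j b^(1+j)
-- collapses to (1 + j) u b^j.
weighted-AM-GM : ∀ j u v → suc j ^ suc j * (u * v ^ j) ≤ (u + j * v) ^ suc j
weighted-AM-GM j u v = +-cancelʳ-≤ (j * b ^ suc j) _ _ (begin
    suc j ^ suc j * (u * v ^ j) + j * (suc j * v * b ^ j)
  ≡⟨ cong (λ t → suc j ^ suc j * (u * v ^ j) + j * (suc j * v * t)) (^-distribʳ-* (suc j) v j) ⟩
    suc j * suc j ^ j * (u * v ^ j) + j * (suc j * v * (suc j ^ j * v ^ j))
  ≡⟨ eq j u v (suc j ^ j) (v ^ j) ⟩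
    suc j * ((u + j * v) * (suc j ^ j * v ^ j))
  ≡⟨ cong (λ t → suc j * ((u + j * v) * t)) (^-distribʳ-* (suc j) v j) ⟨
    suc j * ((u + j * v) * b ^ j)
  ≤⟨ bernoulli j (u + j * v) b ⟩
    (u + j * v) ^ suc j + j * b ^ suc j
  ∎)
  where
  open ≤-Reasoning
  b = suc j * v
  eq : ∀ j u v s t → suc j * s * (u * t) + j * (suc j * v * (s * t))
                   ≡ suc j * ((u + j * v) * (s * t))
  eq = solve-∀

-- If the superadditivity below failed for P = x + X, Q = y + Y and s = n + m,
-- AM-GM would give n / s ≤ (x / P + j y / Q) / (1 + j), and the two such bounds add up to 1 ≤ 1,
-- one of them being strict.
module _ (j C x y n P Q s : ℕ) (Cnᵏ≤xyʲ : C * n ^ suc j ≤ x * y ^ j) where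
  private
    -- Cleared of denominators, the bound on n / s compares (1 + j) n P Q with a multiple of s. The
    -- factor `c` is what remains of ((1 + j) n P Q)^(1+j) once P Q^j, the quantity bounded by `lt`,
    -- is taken out.
    c = suc j ^ suc j * n ^ suc j * (Q * P ^ j)

    split : (suc j * n * (P * Q)) ^ suc j ≡ c * (P * Q ^ j)
    split = trans (^-distribʳ-* (suc j * n) (P * Q) (suc j))
      (trans (cong₂ (λ u v → u * (P * Q * v)) (^-distribʳ-* (suc j) n (suc j)) (^-distribʳ-* P Q j))
             (eq (suc j ^ suc j) (n ^ suc j) P Q (P ^ j) (Q ^ j)))
      where
      eq : ∀ K N P Q p q → K * N * (P * Q * (p * q)) ≡ K * N * (Q * p) * (P * q)
      eq = solve-∀

    bound : c * (C * s ^ suc j) ≤ ((x * Q + j * (y * P)) * s) ^ suc j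
    bound = begin
        c * (C * s ^ suc j)
      ≡⟨ eq₁ (suc j ^ suc j) (n ^ suc j) (Q * P ^ j) C (s ^ suc j) ⟩
        suc j ^ suc j * (Q * P ^ j) * s ^ suc j * (C * n ^ suc j)
      ≤⟨ *-monoʳ-≤ (suc j ^ suc j * (Q * P ^ j) * s ^ suc j) Cnᵏ≤xyʲ ⟩
        suc j ^ suc j * (Q * P ^ j) * s ^ suc j * (x * y ^ j)
      ≡⟨ eq₂ (suc j ^ suc j) Q (P ^ j) (s ^ suc j) x (y ^ j) ⟩
        suc j ^ suc j * (x * Q * (y ^ j * P ^ j)) * s ^ suc j
      ≡⟨ cong (λ t → suc j ^ suc j * (x * Q * t) * s ^ suc j) (^-distribʳ-* y P j) ⟨
        suc j ^ suc j * (x * Q * (y * P) ^ j) * s ^ suc j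
      ≤⟨ *-monoˡ-≤ (s ^ suc j) (weighted-AM-GM j (x * Q) (y * P)) ⟩
        (x * Q + j * (y * P)) ^ suc j * s ^ suc j
      ≡⟨ ^-distribʳ-* (x * Q + j * (y * P)) s (suc j) ⟨
        ((x * Q + j * (y * P)) * s) ^ suc j
      ∎
      where
      open ≤-Reasoning
      eq₁ : ∀ K N R C S → K * N * R * (C * S) ≡ K * R * S * (C * N)
      eq₁ = solve-∀
      eq₂ : ∀ K Q p S x y → K * (Q * p) * S * (x * y) ≡ K * (x * Q * (y * p)) * S
      eq₂ = solve-∀

  share-≤ : P * Q ^ j < C * s ^ suc j → suc j * n * (P * Q) ≤ (x * Q + j * (y * P)) * s
  share-≤ lt = ^-cancelˡ-≤ j
    (≤-trans (≤-reflexive split) (≤-trans (*-monoʳ-≤ c (<⇒≤ lt)) bound))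

  share-< : .{{NonZero n}} → .{{NonZero P}} → .{{NonZero Q}} →
            P * Q ^ j < C * s ^ suc j → suc j * n * (P * Q) < (x * Q + j * (y * P)) * s
  -- Positivity of n, P and Q makes `c` nonzero, so multiplying by it keeps `lt` strict.
  share-< lt = ^-cancelˡ-< (suc j)
    (≤-<-trans (≤-reflexive split) (<-≤-trans (*-monoʳ-< c {{c≢0}} lt) bound))
    where
    c≢0 : NonZero c
    c≢0 = m*n≢0 (suc j ^ suc j * n ^ suc j) (Q * P ^ j)
            {{m*n≢0 _ _ {{m^n≢0 (suc j) (suc j)}} {{m^n≢0 n (suc j)}}}}
            {{m*n≢0 Q _ {{it}} {{m^n≢0 P j}}}}

geometric-mean-superadditive : ∀ j C {x y n X Y m} →
  C * n ^ suc j ≤ x * y ^ j → C * m ^ suc j ≤ X * Y ^ j →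
  C * (n + m) ^ suc j ≤ (x + X) * (y + Y) ^ j
-- At j = 0 the power of y is 1 whatever y is, and the hypotheses simply add. For positive j a
-- vanishing y makes the product vanish.
geometric-mean-superadditive zero C {x} {y} {n} {X} {Y} {m} p q =
  subst₂ _≤_ (eq₁ C n m) (eq₂ x X) (+-mono-≤ p q)
  where
  eq₁ : ∀ C n m → C * (n * 1) + C * (m * 1) ≡ C * ((n + m) * 1)
  eq₁ = solve-∀
  eq₂ : ∀ x X → x * 1 + X * 1 ≡ (x + X) * 1
  eq₂ = solve-∀
geometric-mean-superadditive (suc i) zero p q = z≤n
geometric-mean-superadditive (suc i) (suc C) {x} {y} {zero} {X} {Y} {m} p q =
  ≤-trans q (*-mono-≤ (m≤n+m X x) (^-monoˡ-≤ (suc i) (m≤n+m Y y)))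
-- With C and n positive the left side of `p` is at least 1, which excludes x = 0 and y = 0; the
-- final case can then divide by x + X and y + Y.
geometric-mean-superadditive (suc i) (suc C) {zero} {y} {suc n} p q =
  contradiction (≤-trans (*-mono-≤ (s≤s (z≤n {C})) (m^n>0 (suc n) (2 + i))) p) λ ()
geometric-mean-superadditive (suc i) (suc C) {suc x} {zero} {suc n} p q =
  contradiction
    (≤-trans (*-mono-≤ (s≤s (z≤n {C})) (m^n>0 (suc n) (2 + i))) (≤-trans p (≤-reflexive (*-zeroʳ (suc x))))) λ ()
geometric-mean-superadditive j@(suc i) C@(suc _) {x@(suc _)} {y@(suc _)} {n@(suc _)} {X} {Y} {m} p q =
  ≮⇒≥ λ lt → <-irrefl (eq j x y n X Y m)
    (+-mono-<-≤ (share-< j C x y n (x + X) (y + Y) (n + m) p lt)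
                (share-≤ j C X Y m (x + X) (y + Y) (n + m) q lt))
  where
  eq : ∀ j x y n X Y m →
    suc j * n * ((x + X) * (y + Y)) + suc j * m * ((x + X) * (y + Y)) ≡
    (x * (y + Y) + j * (y * (x + X))) * (n + m) + (X * (y + Y) + j * (Y * (x + X))) * (n + m)
  eq = solve-∀

-- For positive j, AM-GM for the value 1 and j - 1 copies of 1 + j, whose sum is j^2, gives j^j
-- (1+j)^(j-1) ≤ j^(2j); cancel j^j. This pays for the factor k^j on every layer above the bottom
-- one.
[1+j]^j≤[1+j]*j^j : ∀ j → suc j ^ j ≤ suc j * j ^ j
[1+j]^j≤[1+j]*j^j zero      = s≤s z≤n
[1+j]^j≤[1+j]*j^j j@(suc i) = *-monoʳ-≤ (suc j) (*-cancelˡ-≤ (j ^ j) {{m^n≢0 j j}} (begin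
    j ^ j * suc j ^ i        ≡⟨ cong (j ^ j *_) (*-identityˡ (suc j ^ i)) ⟨
    j ^ j * (1 * suc j ^ i)  ≤⟨ weighted-AM-GM i 1 (suc j) ⟩
    (1 + i * suc j) ^ j      ≡⟨ cong (_^ j) (eq i) ⟩
    (j * j) ^ j              ≡⟨ ^-distribʳ-* j j j ⟩
    j ^ j * j ^ j            ∎))
  where
  open ≤-Reasoning
  eq : ∀ i → 1 + i * suc (suc i) ≡ suc i * suc i
  eq = solve-∀

-- Counting distinct entries of lists.

length-⊆ : {A : Set} {xs ys : List A} → Unique xs → xs ⊆ ys → length xs ≤ length ys
length-⊆ [] _ = z≤n
length-⊆ {xs = x ∷ xs} (x∉xs ∷ u) xs⊆ys with us , vs , refl ← ∈-∃++ (xs⊆ys (here refl)) =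
  ≤-trans (s≤s (length-⊆ u xs⊆us++vs)) (≤-reflexive (sym (length-++-sucʳ us x vs)))
  where
  xs⊆us++vs : xs ⊆ us ++ vs
  xs⊆us++vs z∈xs with ∈-++⁻ us (xs⊆ys (there z∈xs))
  ... | inj₁ z∈us         = ∈-++⁺ˡ z∈us
  ... | inj₂ (here refl)  = contradiction refl (All.lookup x∉xs z∈xs)
  ... | inj₂ (there z∈vs) = ∈-++⁺ʳ us z∈vs

module Distinct {A : Set} (_≟_ : DecidableEquality A) where
  open DecMembership _≟_ using (_∈?_)

  distinct : List A → ℕ
  distinct xs = length (deduplicate _≟_ xs)

  ⊆-deduplicate : ∀ {xs} → xs ⊆ deduplicate _≟_ xs
  ⊆-deduplicate = ∈-deduplicate⁺ _≟_

  deduplicate-⊆ : ∀ {xs} → deduplicate _≟_ xs ⊆ xs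
  deduplicate-⊆ {xs} = ∈-deduplicate⁻ _≟_ xs

  distinct-≤-length : ∀ {xs ys} → xs ⊆ ys → distinct xs ≤ length ys
  distinct-≤-length {xs} xs⊆ys =
    length-⊆ (UniqueDec.deduplicate-! _≟_ xs) (xs⊆ys ∘ deduplicate-⊆)

  length-≤-distinct : ∀ {xs ys} → Unique xs → xs ⊆ ys → length xs ≤ distinct ys
  length-≤-distinct u xs⊆ys = length-⊆ u (⊆-deduplicate ∘ xs⊆ys)

  distinct-mono : ∀ {xs ys} → xs ⊆ ys → distinct xs ≤ distinct ys
  distinct-mono xs⊆ys = distinct-≤-length (⊆-deduplicate ∘ xs⊆ys)

  ∈⇒0<distinct : ∀ {x xs} → x ∈ xs → 0 < distinct xs
  ∈⇒0<distinct x∈xs = length-≤-distinct ([] ∷ []) λ { (here refl) → x∈xs }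

  0<distinct⇒∈ : ∀ {xs} → 0 < distinct xs → ∃ (_∈ xs)
  0<distinct⇒∈ {x ∷ xs} _ = x , here refl

  -- Numeric membership turns cardinalities into sums over one common list, where they can be
  -- compared point by point.
  indicator : List A → A → ℕ
  indicator xs y = if does (y ∈? xs) then 1 else 0

  indicator-∈ : ∀ {xs y} → y ∈ xs → indicator xs y ≡ 1
  indicator-∈ {xs} {y} y∈xs with y ∈? xs
  ... | yes _   = refl
  ... | no y∉xs = contradiction y∈xs y∉xs

  indicator-∉ : ∀ {xs y} → ¬ (y ∈ xs) → indicator xs y ≡ 0
  indicator-∉ {xs} {y} y∉xs with y ∈? xs
  ... | yes y∈xs = contradiction y∈xs y∉xs
  ... | no _     = refl

  indicator-≤1 : ∀ xs y → indicator xs y ≤ 1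
  indicator-≤1 xs y with y ∈? xs
  ... | yes _ = ≤-refl
  ... | no  _ = z≤n

  sum-indicator : ∀ xs ys → sum (map (indicator xs) ys) ≡ length (filter (_∈? xs) ys)
  sum-indicator xs []       = refl
  sum-indicator xs (y ∷ ys) with y ∈? xs
  ... | yes _ = cong suc (sum-indicator xs ys)
  ... | no  _ = sum-indicator xs ys

  distinct-≤-sum-indicator : ∀ {xs ys} → xs ⊆ ys → distinct xs ≤ sum (map (indicator xs) ys)
  distinct-≤-sum-indicator {xs} {ys} xs⊆ys =
    ≤-trans (distinct-≤-length λ x∈xs → ∈-filter⁺ (_∈? xs) (xs⊆ys x∈xs) x∈xs)
            (≤-reflexive (sym (sum-indicator xs ys)))

  sum-indicator-≤-distinct : ∀ xs {ys} → Unique ys → sum (map (indicator xs) ys) ≤ distinct xs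
  sum-indicator-≤-distinct xs {ys} u =
    ≤-trans (≤-reflexive (sum-indicator xs ys))
            (length-≤-distinct (Unique.filter⁺ (_∈? xs) u) (proj₂ ∘ ∈-filter⁻ (_∈? xs) {xs = ys}))

module ℤ-Distinct = Distinct ℤ._≟_
module Card {d} = Distinct (_≟ₚ_ {d})

-- Sumsets in ℤ.

-- Stated for an arbitrary total order so that flipping the order yields the maximum as well as the
-- minimum.
extremum : {A : Set} {_≼_ : A → A → Set} → Total _≼_ → Transitive _≼_ →
           ∀ {x xs} → x ∈ xs → ∃ λ m → m ∈ xs × (∀ {y} → y ∈ xs → m ≼ y)
extremum {_≼_ = _≼_} total ≼-trans {xs = x ∷ xs} _ = go x xs
  where
  ≼-refl : ∀ {x} → x ≼ x
  ≼-refl {x} with total x x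
  ... | inj₁ p = p
  ... | inj₂ p = p
  go : ∀ x xs → ∃ λ m → m ∈ x ∷ xs × (∀ {y} → y ∈ x ∷ xs → m ≼ y)
  go x [] = x , here refl , λ { (here refl) → ≼-refl }
  go x (x′ ∷ xs) with go x′ xs
  ... | m , m∈ , m≼ with total x m
  ... | inj₁ x≼m = x , here refl , λ { (here refl) → ≼-refl ; (there y∈) → ≼-trans x≼m (m≼ y∈) }
  ... | inj₂ m≼x = m , there m∈  , λ { (here refl) → m≼x ; (there y∈) → m≼ y∈ }

-- With x⁺ = max X and y⁻ = min Y, the sums in X + y⁻ lie below those in x⁺ + (Y ∖ y⁻).
ℤ-sumset : ∀ {x y} X Y Z → x ∈ X → y ∈ Y → (∀ {x y} → x ∈ X → y ∈ Y → x ℤ.+ y ∈ Z) →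
           ℤ-Distinct.distinct X + ℤ-Distinct.distinct Y ≤ suc (ℤ-Distinct.distinct Z)
ℤ-sumset X Y Z x∈X y∈Y X+Y⊆Z
  with x⁺ , x⁺∈X , ≤x⁺ ← extremum {_≼_ = flip ℤ._≤_} (flip ℤ.≤-total) (flip ℤ.≤-trans) x∈X
     | y⁻ , y⁻∈Y , y⁻≤ ← extremum ℤ.≤-total ℤ.≤-trans y∈Y = begin
    length xs + length ys
  ≤⟨ +-monoʳ-≤ (length xs) (length-⊆ (UniqueDec.deduplicate-! ℤ._≟_ Y) ys⊆y⁻∷rest) ⟩
    length xs + suc (length rest)
  ≡⟨ +-suc (length xs) (length rest) ⟩
    suc (length xs + length rest)
  ≡⟨ cong suc (cong₂ _+_ (length-map (ℤ._+ y⁻) xs) (length-map x⁺+_ rest)) ⟨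
    suc (length (map (ℤ._+ y⁻) xs) + length (map x⁺+_ rest))
  ≡⟨ cong suc (length-++ (map (ℤ._+ y⁻) xs)) ⟨
    suc (length (map (ℤ._+ y⁻) xs ++ map x⁺+_ rest))
  ≤⟨ s≤s (ℤ-Distinct.length-≤-distinct unique ⊆Z) ⟩
    suc (ℤ-Distinct.distinct Z)
  ∎
  where
  open ≤-Reasoning
  xs = deduplicate ℤ._≟_ X
  ys = deduplicate ℤ._≟_ Y
  x⁺+_ : ℤ → ℤ
  x⁺+ y = x⁺ ℤ.+ y
  ≢y⁻? = λ y → ¬? (y ℤ.≟ y⁻)
  rest = filter ≢y⁻? ys
  ys⊆y⁻∷rest : ys ⊆ y⁻ ∷ rest
  ys⊆y⁻∷rest {y} y∈ys with y ℤ.≟ y⁻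
  ... | yes refl = here refl
  ... | no y≢y⁻  = there (∈-filter⁺ ≢y⁻? y∈ys y≢y⁻)
  ⊆Z : map (ℤ._+ y⁻) xs ++ map x⁺+_ rest ⊆ Z
  ⊆Z z∈ with ∈-++⁻ (map (ℤ._+ y⁻) xs) z∈
  ... | inj₁ z∈ˡ with x , x∈xs , refl ← ∈-map⁻ (ℤ._+ y⁻) z∈ˡ =
    X+Y⊆Z (ℤ-Distinct.deduplicate-⊆ x∈xs) y⁻∈Y
  ... | inj₂ z∈ʳ with y , y∈rest , refl ← ∈-map⁻ x⁺+_ z∈ʳ =
    X+Y⊆Z x⁺∈X (ℤ-Distinct.deduplicate-⊆ (proj₁ (∈-filter⁻ ≢y⁻? {xs = ys} y∈rest)))
  unique : Unique (map (ℤ._+ y⁻) xs ++ map x⁺+_ rest)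
  unique = Unique.++⁺
    (Unique.map⁺ (∙-cancelʳ y⁻ _ _) (UniqueDec.deduplicate-! ℤ._≟_ X))
    (Unique.map⁺ (∙-cancelˡ x⁺ _ _) (Unique.filter⁺ ≢y⁻? (UniqueDec.deduplicate-! ℤ._≟_ Y)))
    disjoint
    where
    disjoint : ∀ {z} → ¬ (z ∈ map (ℤ._+ y⁻) xs × z ∈ map x⁺+_ rest)
    disjoint (z∈ˡ , z∈ʳ)
      with x , x∈xs , refl ← ∈-map⁻ (ℤ._+ y⁻) z∈ˡ
         | y , y∈rest , eq ← ∈-map⁻ x⁺+_ z∈ʳ
      with y∈ys , y≢y⁻ ← ∈-filter⁻ ≢y⁻? {xs = ys} y∈rest =
      ℤ.<-irrefl eq (ℤ.+-mono-≤-< (≤x⁺ (ℤ-Distinct.deduplicate-⊆ x∈xs))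
        (ℤ.≤∧≢⇒< (y⁻≤ (ℤ-Distinct.deduplicate-⊆ y∈ys)) (y≢y⁻ ∘ sym)))

-- Fibres over the projection that forgets the first coordinate.

fibre : ∀ {d} → List (Point (suc d)) → Point d → List ℤ
fibre A y = map head (filter (λ v → tail v ≟ₚ y) A)

∈-fibre⁺ : ∀ {d} {A : List (Point (suc d))} {t y} → t ∷ y ∈ A → t ∈ fibre A y
∈-fibre⁺ ty∈A = ∈-map⁺ head (∈-filter⁺ _ ty∈A refl)

∈-fibre⁻ : ∀ {d} (A : List (Point (suc d))) {t y} → t ∈ fibre A y → t ∷ y ∈ A
∈-fibre⁻ A t∈ with (t ∷ y) , v∈ , refl ← ∈-map⁻ head t∈
  with v∈A , refl ← ∈-filter⁻ _ {xs = A} v∈ = v∈A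

height : ∀ {d} → List (Point (suc d)) → Point d → ℕ
height A y = ℤ-Distinct.distinct (fibre A y)

-- Supplies the cut-off for layer sums: no point lies in a layer of index `length A` or more.
height-≤-length : ∀ {d} (A : List (Point (suc d))) y → height A y ≤ length A
height-≤-length A y =
  ≤-trans (length-deduplicate ℤ._≟_ (fibre A y))
    (≤-trans (≤-reflexive (length-map head (filter (λ v → tail v ≟ₚ y) A))) (length-filter _ A))

0<height⇒∈ : ∀ {d} (A : List (Point (suc d))) {y} → 0 < height A y → y ∈ map tail A
0<height⇒∈ A 0<h with t , t∈ ← ℤ-Distinct.0<distinct⇒∈ 0<h = ∈-map⁺ tail (∈-fibre⁻ A t∈)

-- All sums of the two fibres lie over `y ⊕ z`, so `ℤ-sumset` applies; positive heights make the
-- fibres nonempty.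
height-⊕ : ∀ {d} (A B : List (Point (suc d))) {y z} → 0 < height A y → 0 < height B z →
           height A y + height B z ≤ suc (height (sumset A B) (y ⊕ z))
height-⊕ A B {y} {z} 0<a 0<b =
  ℤ-sumset (fibre A y) (fibre B z) (fibre (sumset A B) (y ⊕ z))
    (proj₂ (ℤ-Distinct.0<distinct⇒∈ 0<a)) (proj₂ (ℤ-Distinct.0<distinct⇒∈ 0<b))
    λ s∈ t∈ → ∈-fibre⁺ (∈-cartesianProductWith⁺ _⊕_ (∈-fibre⁻ A s∈) (∈-fibre⁻ B t∈))

length-concatMap : {A B : Set} (f : A → List B) (xs : List A) →
                   length (concatMap f xs) ≡ sum (map (length ∘ f) xs)
length-concatMap f []       = refl
length-concatMap f (x ∷ xs) =
  trans (length-++ (f x)) (cong (length (f x) +_) (length-concatMap f xs))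

column : ∀ {d} → List (Point (suc d)) → Point d → List (Point (suc d))
column A y = map (_∷ y) (deduplicate ℤ._≟_ (fibre A y))

∈-column⁻ : ∀ {d} (A : List (Point (suc d))) y {v} → v ∈ column A y → v ∈ A × tail v ≡ y
∈-column⁻ A y v∈ with t , t∈ , refl ← ∈-map⁻ (_∷ y) v∈ =
  ∈-fibre⁻ A (ℤ-Distinct.deduplicate-⊆ t∈) , refl

sum-height : ∀ {d} (A : List (Point (suc d))) ys →
             sum (map (height A) ys) ≡ length (concatMap (column A) ys)
sum-height A ys = trans
  (cong sum (map-cong (λ y → sym (length-map (_∷ y) (deduplicate ℤ._≟_ (fibre A y)))) ys))
  (sym (length-concatMap (column A) ys))

card-≤-sum-height : ∀ {d} (A : List (Point (suc d))) {ys} → map tail A ⊆ ys →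
                    card A ≤ sum (map (height A) ys)
card-≤-sum-height A {ys} tails⊆ys =
  ≤-trans (Card.distinct-≤-length A⊆columns) (≤-reflexive (sym (sum-height A ys)))
  where
  A⊆columns : A ⊆ concatMap (column A) ys
  A⊆columns {t ∷ y} v∈A = ∈-concatMap⁺ (column A)
    (Any.map (λ { refl → ∈-map⁺ (_∷ y) (ℤ-Distinct.⊆-deduplicate (∈-fibre⁺ v∈A)) })
             (tails⊆ys (∈-map⁺ tail v∈A)))

-- Columns over distinct base points are disjoint, so a duplicate-free `ys` counts no point of `A`
-- twice.
sum-height-≤-card : ∀ {d} (A : List (Point (suc d))) {ys} → Unique ys →
                    sum (map (height A) ys) ≤ card A
sum-height-≤-card A {ys} u =
  ≤-trans (≤-reflexive (sum-height A ys)) (Card.length-≤-distinct unique ⊆A)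
  where
  unique : Unique (concatMap (column A) ys)
  unique = Unique.concat⁺
    (All.map⁺ (All.universal (λ y → Unique.map⁺ (cong head) (UniqueDec.deduplicate-! ℤ._≟_ (fibre A y))) ys))
    (AllPairs.map⁺ (AllPairs.map disjoint u))
    where
    disjoint : ∀ {y z} → y ≢ z → ∀ {v} → ¬ (v ∈ column A y × v ∈ column A z)
    disjoint {y} {z} y≢z (v∈y , v∈z) =
      y≢z (trans (sym (proj₂ (∈-column⁻ A y v∈y))) (proj₂ (∈-column⁻ A z v∈z)))
  ⊆A : concatMap (column A) ys ⊆ A
  ⊆A v∈ with y , v∈col ← Any.satisfied (∈-concatMap⁻ (column A) {xs = ys} v∈) =
    proj₁ (∈-column⁻ A y v∈col)

-- Layer-cake summation over superlevel sets.

-- The bottom layer has its own weight. The weights (1, 1), (1, k) and (k, j) occur, for A, kA and U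
-- + jA respectively.
ladder : ℕ → ℕ → (ℕ → ℕ) → ℕ → ℕ
ladder a b f zero    = a * f 0
ladder a b f (suc J) = ladder a b f J + b * f (suc J)

ladder-mono : ∀ a b {f g} → (∀ i → f i ≤ g i) → ∀ J → ladder a b f J ≤ ladder a b g J
ladder-mono a b f≤g zero    = *-monoʳ-≤ a (f≤g 0)
ladder-mono a b f≤g (suc J) = +-mono-≤ (ladder-mono a b f≤g J) (*-monoʳ-≤ b (f≤g (suc J)))

sum-mono : {A : Set} {f g : A → ℕ} → (∀ x → f x ≤ g x) → ∀ xs → sum (map f xs) ≤ sum (map g xs)
sum-mono f≤g []       = z≤n
sum-mono f≤g (x ∷ xs) = +-mono-≤ (f≤g x) (sum-mono f≤g xs)

ladder-+ : ∀ a b f g J → ladder a b f J + ladder a b g J ≡ ladder a b (λ i → f i + g i) J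
ladder-+ a b f g zero    = sym (*-distribˡ-+ a (f 0) (g 0))
ladder-+ a b f g (suc J) =
  trans (eq b (ladder a b f J) (f (suc J)) (ladder a b g J) (g (suc J)))
        (cong (_+ b * (f (suc J) + g (suc J))) (ladder-+ a b f g J))
  where
  eq : ∀ b F x G y → F + b * x + (G + b * y) ≡ F + G + b * (x + y)
  eq = solve-∀

ladder-0 : ∀ a b J → ladder a b (λ _ → 0) J ≡ 0
ladder-0 a b zero    = *-zeroʳ a
ladder-0 a b (suc J) = cong₂ _+_ (ladder-0 a b J) (*-zeroʳ b)

sum-ladder : ∀ {A : Set} a b (f : ℕ → A → ℕ) J xs →
             sum (map (λ x → ladder a b (λ i → f i x) J) xs) ≡
             ladder a b (λ i → sum (map (f i) xs)) J
sum-ladder a b f J []       = sym (ladder-0 a b J)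
sum-ladder a b f J (x ∷ xs) =
  trans (cong (ladder a b (λ i → f i x) J +_) (sum-ladder a b f J xs))
        (ladder-+ a b (λ i → f i x) (λ i → sum (map (f i) xs)) J)

ladder-≤-top : ∀ a b {f} → (∀ i → f i ≤ 1) → ∀ J → ladder a b f J ≤ a + b * J
ladder-≤-top a b f≤1 zero    =
  ≤-trans (*-monoʳ-≤ a (f≤1 0)) (≤-reflexive (eq a b))
  where
  eq : ∀ a b → a * 1 ≡ a + b * 0
  eq = solve-∀
ladder-≤-top a b f≤1 (suc J) =
  ≤-trans (+-mono-≤ (ladder-≤-top a b f≤1 J) (*-monoʳ-≤ b (f≤1 (suc J)))) (≤-reflexive (eq a b J))
  where
  eq : ∀ a b J → a + b * J + b * 1 ≡ a + b * suc J
  eq = solve-∀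

-- The sets `T i` need not be nested. Over a point y only the last index J with y in `T J` matters:
-- the layers up to J contribute at most a + b J, and `steep` at J provides that height.
ladder-card-≤ : ∀ {d} (S : List (Point (suc d))) (T : ℕ → List (Point d)) a b → 0 < a →
                (∀ i {y} → y ∈ T i → a + b * i ≤ height S y) →
                ∀ J → ladder a b (card ∘ T) J ≤ card S
ladder-card-≤ S T a b 0<a steep J = begin
    ladder a b (card ∘ T) J
  ≤⟨ ladder-mono a b (λ i → Card.distinct-≤-sum-indicator (T⊆ys i)) J ⟩
    ladder a b (λ i → sum (map (Card.indicator (T i)) ys)) J
  ≡⟨ sum-ladder a b (λ i → Card.indicator (T i)) J ys ⟨
    sum (map (λ y → ladder a b (λ i → Card.indicator (T i) y) J) ys)
  ≤⟨ sum-mono (pointwise J) ys ⟩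
    sum (map (height S) ys)
  ≤⟨ sum-height-≤-card S (UniqueDec.deduplicate-! _≟ₚ_ (map tail S)) ⟩
    card S
  ∎
  where
  open ≤-Reasoning
  open DecMembership _≟ₚ_ using (_∈?_)
  ys = deduplicate _≟ₚ_ (map tail S)
  T⊆ys : ∀ i → T i ⊆ ys
  T⊆ys i y∈T = Card.⊆-deduplicate
    (0<height⇒∈ S (≤-trans 0<a (≤-trans (m≤m+n a (b * i)) (steep i y∈T))))
  pointwise : ∀ J y → ladder a b (λ i → Card.indicator (T i) y) J ≤ height S y
  pointwise J y with y ∈? T J
  pointwise J       y | yes y∈T =
    ≤-trans (ladder-≤-top a b (λ i → Card.indicator-≤1 (T i) y) J) (steep J y∈T)
  pointwise zero    y | no y∉T rewrite Card.indicator-∉ y∉T = ≤-trans (≤-reflexive (*-zeroʳ a)) z≤n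
  pointwise (suc J) y | no y∉T rewrite Card.indicator-∉ y∉T | *-zeroʳ b =
    ≤-trans (≤-reflexive (+-identityʳ _)) (pointwise J y)

-- The i-th layer of A after pushing every fibre down to an initial segment of ℕ.
superlevel : ∀ {d} → List (Point (suc d)) → ℕ → List (Point d)
superlevel A i = filter (λ y → i <? height A y) (map tail A)

∈-superlevel⁺ : ∀ {d} (A : List (Point (suc d))) i {y} → i < height A y → y ∈ superlevel A i
∈-superlevel⁺ A i i<h = ∈-filter⁺ (λ y → i <? height A y) (0<height⇒∈ A (≤-<-trans z≤n i<h)) i<h

∈-superlevel⁻ : ∀ {d} (A : List (Point (suc d))) i {y} → y ∈ superlevel A i → i < height A y
∈-superlevel⁻ A i y∈ = proj₂ (∈-filter⁻ (λ y → i <? height A y) {xs = map tail A} y∈)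

-- A point of height h lies in the layers 0, ..., h - 1, so summing its indicators over the layers
-- recovers h.
card-≤-ladder-superlevel : ∀ {d} (A : List (Point (suc d))) →
                           card A ≤ ladder 1 1 (card ∘ superlevel A) (length A)
card-≤-ladder-superlevel A = begin
    card A
  ≤⟨ card-≤-sum-height A Card.⊆-deduplicate ⟩
    sum (map (height A) ys)
  ≤⟨ sum-mono (λ y → pointwise y (length A) ≤-refl (m≤n⇒m≤1+n (height-≤-length A y))) ys ⟩
    sum (map (λ y → ladder 1 1 (λ i → Card.indicator (superlevel A i) y) (length A)) ys)
  ≡⟨ sum-ladder 1 1 (λ i → Card.indicator (superlevel A i)) (length A) ys ⟩
    ladder 1 1 (λ i → sum (map (Card.indicator (superlevel A i)) ys)) (length A)
  ≤⟨ ladder-mono 1 1 (λ i → Card.sum-indicator-≤-distinct (superlevel A i)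
       (UniqueDec.deduplicate-! _≟ₚ_ (map tail A))) (length A) ⟩
    ladder 1 1 (card ∘ superlevel A) (length A)
  ∎
  where
  open ≤-Reasoning
  ys = deduplicate _≟ₚ_ (map tail A)
  -- The layers 0, ..., J number J + 1, hence the bound `suc J`. The truncated height `h` can shrink
  -- along with J in the induction.
  pointwise : ∀ y J {h} → h ≤ height A y → h ≤ suc J →
              h ≤ ladder 1 1 (λ i → Card.indicator (superlevel A i) y) J
  pointwise y zero    {zero}        _  _         = z≤n
  pointwise y zero    {suc zero}    h≤ _         =
    ≤-reflexive (sym (cong (1 *_) (Card.indicator-∈ (∈-superlevel⁺ A 0 h≤))))
  pointwise y zero    {suc (suc _)} _  (s≤s ())
  pointwise y (suc J) {h}           h≤ h≤2+J with m≤n⇒m<n∨m≡n h≤2+J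
  ... | inj₁ (s≤s h≤1+J) = ≤-trans (pointwise y J h≤ h≤1+J) (m≤m+n _ _)
  ... | inj₂ refl = ≤-trans (≤-reflexive (+-comm 1 (suc J)))
    (+-mono-≤ (pointwise y J (<⇒≤ h≤) ≤-refl)
              (≤-reflexive (sym (cong (1 *_) (Card.indicator-∈ (∈-superlevel⁺ A (suc J) h≤))))))

-- Each of the m summands has height at least i + 1, and each of the m - 1 additions loses at most
-- one. For m = 0 the origin alone has height 1.
height-mult : ∀ {d} (A : List (Point (suc d))) i m {y} → y ∈ mult m (superlevel A i) →
              1 + m * i ≤ height (mult m A) y
height-mult A i zero (here refl) = ℤ-Distinct.∈⇒0<distinct (∈-fibre⁺ {A = mult 0 A} (here refl))
height-mult A i (suc zero) y∈ =
  ≤-trans (≤-reflexive (cong suc (+-identityʳ i))) (∈-superlevel⁻ A i y∈)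
height-mult A i (suc (suc m)) y∈
  with IH ← (λ z → height-mult A i (suc m) {z})
  with y₁ , y₂ , y₁∈ , y₂∈ , refl ← ∈-cartesianProductWith⁻ _⊕_ (superlevel A i) _ y∈ =
  s≤s⁻¹ (begin
    2 + (suc (suc m) * i)
  ≡⟨ eq m i ⟩
    suc i + (1 + suc m * i)
  ≤⟨ +-mono-≤ h₁ h₂ ⟩
    height A y₁ + height (mult (suc m) A) y₂
  ≤⟨ height-⊕ A (mult (suc m) A) (≤-<-trans z≤n h₁) (≤-<-trans z≤n h₂) ⟩
    suc (height (mult (suc (suc m)) A) (y₁ ⊕ y₂))
  ∎)
  where
  open ≤-Reasoning
  h₁ : suc i ≤ height A y₁
  h₁ = ∈-superlevel⁻ A i y₁∈
  h₂ : 1 + suc m * i ≤ height (mult (suc m) A) y₂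
  h₂ = IH y₂ y₂∈
  eq : ∀ m i → 2 + (suc (suc m) * i) ≡ suc i + (1 + suc m * i)
  eq = solve-∀

-- Discrete cubes and their multiples.

cube : ℕ → (d : ℕ) → List (Point d)
cube m zero    = [ [] ]
cube m (suc d) = cartesianProductWith (λ i v → (ℤ.+ i) ∷ v) (upTo m) (cube m d)

∈-cube-∷ : ∀ {m d i} {v : Point d} → i < m → v ∈ cube m d → (ℤ.+ i) ∷ v ∈ cube m (suc d)
∈-cube-∷ i<m v∈ = ∈-cartesianProductWith⁺ (λ i v → (ℤ.+ i) ∷ v) (∈-upTo⁺ i<m) v∈

height-cube : ∀ m {d} {y : Point d} → y ∈ cube m d → m ≤ height (cube m (suc d)) y
height-cube m {d} {y} y∈ = ≤-trans
  (≤-reflexive (sym (trans (length-map (λ i → ℤ.+ i) (upTo m)) (length-upTo m))))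
  (ℤ-Distinct.length-≤-distinct (Unique.map⁺ ℤ.+-injective (Unique.upTo⁺ m)) ⊆fibre)
  where
  ⊆fibre : map (λ i → ℤ.+ i) (upTo m) ⊆ fibre (cube m (suc d)) y
  ⊆fibre t∈ with i , i∈ , refl ← ∈-map⁻ (λ i → ℤ.+ i) t∈ =
    ∈-fibre⁺ (∈-cube-∷ (∈-upTo⁻ i∈) y∈)

length-cube : ∀ m d → length (cube m d) ≡ m ^ d
length-cube m zero    = refl
length-cube m (suc d) = trans (go (upTo m)) (cong₂ _*_ (length-upTo m) (length-cube m d))
  where
  go : ∀ is → length (cartesianProductWith (λ i v → (ℤ.+ i) ∷ v) is (cube m d)) ≡ length is * length (cube m d)
  go []       = refl
  go (i ∷ is) = trans (length-++ (map ((ℤ.+ i) ∷_) (cube m d)))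
                      (cong₂ _+_ (length-map ((ℤ.+ i) ∷_) (cube m d)) (go is))

unique-cube : ∀ m d → Unique (cube m d)
unique-cube m zero    = [] ∷ []
unique-cube m (suc d) = Unique.cartesianProductWith⁺ (λ i v → (ℤ.+ i) ∷ v)
  (λ { refl → refl , refl }) (Unique.upTo⁺ m) (unique-cube m d)

card-cube : ∀ m d → card (cube m d) ≡ m ^ d
card-cube m d = ≤-antisym
  (≤-trans (length-deduplicate _≟ₚ_ (cube m d)) (≤-reflexive (length-cube m d)))
  (≤-trans (≤-reflexive (sym (length-cube m d))) (Card.length-≤-distinct (unique-cube m d) λ v∈ → v∈))

cube-containsCube : ∀ m d → ContainsCube m (cube m d)
cube-containsCube m zero    []      = here refl
cube-containsCube m (suc d) (i ∷ f) = ∈-cube-∷ (toℕ<n i) (cube-containsCube m d f)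

∈-cube⁻ : ∀ m d {v : Point d} → v ∈ cube m d → Σ[ f ∈ Vec (Fin m) d ] v ≡ vmap (λ i → ℤ.+ toℕ i) f
∈-cube⁻ m zero    (here refl) = [] , refl
∈-cube⁻ m (suc d) v∈
  with i , w , i∈ , w∈ , refl ← ∈-cartesianProductWith⁻ (λ i v → (ℤ.+ i) ∷ v) (upTo m) _ v∈
  with f , refl ← ∈-cube⁻ m d w∈ =
  fromℕ< (∈-upTo⁻ i∈) ∷ f , cong (λ j → (ℤ.+ j) ∷ _) (sym (toℕ-fromℕ< (∈-upTo⁻ i∈)))

cube-⊆ : ∀ m d {A : List (Point d)} → ContainsCube m A → cube m d ⊆ A
cube-⊆ m d U⊆A v∈ with f , refl ← ∈-cube⁻ m d v∈ = U⊆A f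

⊕-cube : ∀ a b d {v w : Point d} → v ∈ cube (suc a) d → w ∈ cube (suc b) d →
         v ⊕ w ∈ cube (suc (a + b)) d
⊕-cube a b zero    (here refl) (here refl) = here refl
⊕-cube a b (suc d) v∈ w∈
  with i , v , i∈ , v∈ , refl ← ∈-cartesianProductWith⁻ (λ i v → (ℤ.+ i) ∷ v) (upTo (suc a)) _ v∈
     | j , w , j∈ , w∈ , refl ← ∈-cartesianProductWith⁻ (λ i v → (ℤ.+ i) ∷ v) (upTo (suc b)) _ w∈ =
  ∈-cube-∷ (s≤s (+-mono-≤ (s≤s⁻¹ (∈-upTo⁻ i∈)) (s≤s⁻¹ (∈-upTo⁻ j∈)))) (⊕-cube a b d v∈ w∈)

mult-cube-⊆ : ∀ m j d → mult m (cube (suc j) d) ⊆ cube (suc (m * j)) d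
mult-cube-⊆ zero j zero    (here refl) = here refl
mult-cube-⊆ zero j (suc d) (here refl) = ∈-cube-∷ (s≤s z≤n) (mult-cube-⊆ zero j d (here refl))
mult-cube-⊆ (suc zero) j d v∈ = subst (λ b → _ ∈ cube (suc b) d) (sym (+-identityʳ j)) v∈
mult-cube-⊆ (suc (suc m)) j d v∈
  with IH ← (λ w → mult-cube-⊆ (suc m) j d {w})
  with v , w , v∈ , w∈ , refl ← ∈-cartesianProductWith⁻ _⊕_ (cube (suc j) d) _ v∈ =
  ⊕-cube j (suc m * j) d v∈ (IH w w∈)

⊕-identityʳ : ∀ {d} (v : Point d) → v ⊕ replicate d (ℤ.+ 0) ≡ v
⊕-identityʳ []      = refl
⊕-identityʳ (t ∷ v) = cong₂ _∷_ (ℤ.+-identityʳ t) (⊕-identityʳ v)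

sumset-⊆-mult : ∀ {d} {U A : List (Point d)} j → U ⊆ A → sumset U (mult j A) ⊆ mult (suc j) A
-- Here `mult 0 A` is the origin while `mult 1 A` is `A` itself, so the added zero vector has to be
-- removed.
sumset-⊆-mult {U = U} zero    U⊆A v∈
  with u , _ , u∈U , here refl , refl ← ∈-cartesianProductWith⁻ _⊕_ U _ v∈ =
  subst (_∈ _) (sym (⊕-identityʳ u)) (U⊆A u∈U)
sumset-⊆-mult {U = U} (suc j) U⊆A v∈
  with u , w , u∈U , w∈ , refl ← ∈-cartesianProductWith⁻ _⊕_ U _ v∈ =
  ∈-cartesianProductWith⁺ _⊕_ (U⊆A u∈U) w∈

-- Induction on the dimension, and the theorem.

[]∈mult : ∀ m {A : List (Point 0)} → [] ∈ A → [] ∈ mult m A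
[]∈mult zero          _   = here refl
[]∈mult (suc zero)    []∈ = []∈
[]∈mult (suc (suc m)) []∈ = ∈-cartesianProductWith⁺ _⊕_ []∈ ([]∈mult (suc m) []∈)

-- `A` is arbitrary because the induction applies the bound to superlevel sets, and the high ones
-- need not contain the cube.
sumset-product-bound : ∀ j d (A : List (Point d)) →
  suc j ^ (d * j) * card A ^ suc j ≤
  card (mult (suc j) A) * card (sumset (cube (suc j) d) (mult j A)) ^ j
sumset-product-bound j zero    []           = z≤n
-- ℤ^0 has a single point, so a nonempty `A` has one element and both sides are compared through 1.
sumset-product-bound j zero    A@([] ∷ _) = begin
    1 * card A ^ suc j  ≤⟨ *-monoʳ-≤ 1 (^-monoˡ-≤ (suc j) card≤1) ⟩
    1 * 1 ^ suc j       ≡⟨ cong (1 *_) (^-zeroˡ (suc j)) ⟩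
    1                   ≡⟨ cong (1 *_) (^-zeroˡ j) ⟨
    1 * 1 ^ j           ≤⟨ *-mono-≤ (Card.∈⇒0<distinct ([]∈mult (suc j) (here refl)))
                             (^-monoˡ-≤ j (Card.∈⇒0<distinct
                               (∈-cartesianProductWith⁺ _⊕_ {xs = [ [] ]} (here refl) ([]∈mult j (here refl))))) ⟩
    card (mult (suc j) A) * card (sumset (cube (suc j) 0) (mult j A)) ^ j ∎
  where
  open ≤-Reasoning
  card≤1 : card A ≤ 1
  card≤1 = Card.distinct-≤-length {xs = A} {ys = [ [] ]} λ { {[]} _ → here refl }
sumset-product-bound j (suc d) A = begin
    suc j ^ (suc d * j) * card A ^ suc j
  ≡⟨ cong (_* card A ^ suc j) (^-distribˡ-+-* (suc j) j (d * j)) ⟩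
    C * card A ^ suc j
  ≤⟨ *-monoʳ-≤ C (^-monoˡ-≤ (suc j) (card-≤-ladder-superlevel A)) ⟩
    C * ladder 1 1 (card ∘ L) (length A) ^ suc j
  ≤⟨ ladders (length A) ⟩
    ladder 1 (suc j) (card ∘ S) (length A) * ladder (suc j) j (card ∘ T) (length A) ^ j
  ≤⟨ *-mono-≤
       (ladder-card-≤ (mult (suc j) A) S 1 (suc j) (s≤s z≤n) (λ i → height-mult A i (suc j)) (length A))
       (^-monoˡ-≤ j (ladder-card-≤ (sumset (cube (suc j) (suc d)) (mult j A)) T (suc j) j (s≤s z≤n) steep (length A))) ⟩
    card (mult (suc j) A) * card (sumset (cube (suc j) (suc d)) (mult j A)) ^ j
  ∎
  where
  open ≤-Reasoning
  -- Raising the dimension by one costs the extra factor k^j, which the weights of the layers must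
  -- supply.
  C = suc j ^ j * suc j ^ (d * j)
  L = superlevel A
  S T : ℕ → List (Point d)
  S i = mult (suc j) (L i)
  T i = sumset (cube (suc j) d) (mult j (L i))
  steep : ∀ i {y} → y ∈ T i → suc j + j * i ≤ height (sumset (cube (suc j) (suc d)) (mult j A)) y
  steep i y∈ with u , w , u∈ , w∈ , refl ← ∈-cartesianProductWith⁻ _⊕_ (cube (suc j) d) _ y∈ =
    -- The heights are at least k over `u` and 1 + j i over `w`; the addition loses one.
    s≤s⁻¹ (≤-trans (≤-reflexive (cong suc (sym (+-suc j (j * i)))))
      (≤-trans (+-mono-≤ hᵤ hᵥ)
        (height-⊕ (cube (suc j) (suc d)) (mult j A) (≤-<-trans z≤n hᵤ) (≤-<-trans z≤n hᵥ))))
    where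
    hᵤ = height-cube (suc j) u∈
    hᵥ = height-mult A i j w∈
  IH : ∀ i → suc j ^ (d * j) * card (L i) ^ suc j ≤ card (S i) * card (T i) ^ j
  IH i = sumset-product-bound j d (L i)
  -- On the bottom layer the weight k of the second factor yields k^j exactly.
  bottom : ∀ n s t c → c * n ^ suc j ≤ s * t ^ j →
           suc j ^ j * c * (1 * n) ^ suc j ≤ (1 * s) * (suc j * t) ^ j
  bottom n s t c le = begin
      suc j ^ j * c * (1 * n) ^ suc j  ≡⟨ cong (λ n → suc j ^ j * c * n ^ suc j) (*-identityˡ n) ⟩
      suc j ^ j * c * n ^ suc j        ≡⟨ *-assoc (suc j ^ j) c _ ⟩
      suc j ^ j * (c * n ^ suc j)      ≤⟨ *-monoʳ-≤ (suc j ^ j) le ⟩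
      suc j ^ j * (s * t ^ j)          ≡⟨ eq (suc j ^ j) s (t ^ j) ⟩
      1 * s * (suc j ^ j * t ^ j)      ≡⟨ cong (1 * s *_) (^-distribʳ-* (suc j) t j) ⟨
      1 * s * (suc j * t) ^ j          ∎
    where
    eq : ∀ k s t → k * (s * t) ≡ 1 * s * (k * t)
    eq = solve-∀
  -- On a higher layer the weights k and j yield k j^j, which is at least k^j.
  rung : ∀ n s t c → c * n ^ suc j ≤ s * t ^ j →
         suc j ^ j * c * (1 * n) ^ suc j ≤ (suc j * s) * (j * t) ^ j
  rung n s t c le = begin
      suc j ^ j * c * (1 * n) ^ suc j    ≡⟨ cong (λ n → suc j ^ j * c * n ^ suc j) (*-identityˡ n) ⟩
      suc j ^ j * c * n ^ suc j          ≡⟨ *-assoc (suc j ^ j) c _ ⟩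
      suc j ^ j * (c * n ^ suc j)        ≤⟨ *-mono-≤ ([1+j]^j≤[1+j]*j^j j) le ⟩
      (suc j * j ^ j) * (s * t ^ j)      ≡⟨ eq (suc j) (j ^ j) s (t ^ j) ⟩
      suc j * s * (j ^ j * t ^ j)        ≡⟨ cong (suc j * s *_) (^-distribʳ-* j t j) ⟨
      suc j * s * (j * t) ^ j            ∎
    where
    eq : ∀ k l s t → k * l * (s * t) ≡ k * s * (l * t)
    eq = solve-∀
  ladders : ∀ J → C * ladder 1 1 (card ∘ L) J ^ suc j ≤
                  ladder 1 (suc j) (card ∘ S) J * ladder (suc j) j (card ∘ T) J ^ j
  ladders zero    = bottom (card (L 0)) (card (S 0)) (card (T 0)) (suc j ^ (d * j)) (IH 0)
  ladders (suc J) = geometric-mean-superadditive j C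
    {x = ladder 1 (suc j) (card ∘ S) J} {y = ladder (suc j) j (card ∘ T) J}
    {n = ladder 1 1 (card ∘ L) J}
    {X = suc j * card (S (suc J))} {Y = j * card (T (suc J))} {m = 1 * card (L (suc J))} (ladders J)
    (rung (card (L (suc J))) (card (S (suc J))) (card (T (suc J))) (suc j ^ (d * j)) (IH (suc J)))

-- Both bounds are cleared of fractions and roots. The lower one is the k-th power of the estimate
-- for |kA| / |A|. The upper bound on the infimum says that for every n ≥ 1 some ratio is at most (k
-- - 1 + 1/k)^d + 1/n, with k - 1 + 1/k written as (k² - k + 1) / k.
theorem1p5 : (d k : ℕ) → 1 ≤ d → 1 ≤ k →
    ((A : List (Point d)) → ContainsCube k A →
    k ^ (d * (k ∸ 1)) * card A ^ k ≤ card (mult k A) ^ k)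
    ×
    ((n : ℕ) → 1 ≤ n → Σ[ A ∈ List (Point d) ] (ContainsCube k A ×
    card (mult k A) * k ^ d * n ≤ card A * ((k * k ∸ k + 1) ^ d * n + k ^ d)))
theorem1p5 d (suc j) _ _ = lower , λ n _ → cube k d , cube-containsCube k d , upper n
  where
  open ≤-Reasoning
  k = suc j
  lower : (A : List (Point d)) → ContainsCube k A → k ^ (d * j) * card A ^ k ≤ card (mult k A) ^ k
  lower A U⊆A = ≤-trans (sumset-product-bound j d A)
    (*-monoʳ-≤ (card (mult k A))
      (^-monoˡ-≤ j (Card.distinct-mono (sumset-⊆-mult j (cube-⊆ k d U⊆A)))))
  -- The k-fold sum of {0, ..., j} lies in {0, ..., kj}, which has kj + 1 = k² - k + 1 elements.
  side : suc (k * j) ≡ k * k ∸ k + 1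
  side = trans (+-comm 1 (k * j)) (cong (_+ 1) (sym (trans (cong (_∸ k) (*-suc k j)) (m+n∸m≡n k (k * j)))))
  upper : ∀ n → card (mult k (cube k d)) * k ^ d * n ≤ card (cube k d) * ((k * k ∸ k + 1) ^ d * n + k ^ d)
  upper n = begin
      card (mult k (cube k d)) * k ^ d * n
    ≤⟨ *-monoˡ-≤ n (*-monoˡ-≤ (k ^ d) (Card.distinct-mono (mult-cube-⊆ k j d))) ⟩
      card (cube (suc (k * j)) d) * k ^ d * n
    ≡⟨ cong (λ q → q * k ^ d * n) (trans (card-cube (suc (k * j)) d) (cong (_^ d) side)) ⟩
      (k * k ∸ k + 1) ^ d * k ^ d * n
    ≡⟨ eq ((k * k ∸ k + 1) ^ d) (k ^ d) n ⟩
      k ^ d * ((k * k ∸ k + 1) ^ d * n)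
    ≤⟨ *-monoʳ-≤ (k ^ d) (m≤m+n _ (k ^ d)) ⟩
      k ^ d * ((k * k ∸ k + 1) ^ d * n + k ^ d)
    ≡⟨ cong (_* ((k * k ∸ k + 1) ^ d * n + k ^ d)) (card-cube k d) ⟨
      card (cube k d) * ((k * k ∸ k + 1) ^ d * n + k ^ d)
    ∎
    where
    eq : ∀ q p n → q * p * n ≡ p * (q * n)
    eq = solve-∀
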